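{- Let $m\geq 1$ be an integer, let $\beta\in(0,1)$ be a real number satisfying $\beta^2+m\beta=1$, and let $(G_n)_{n\geq 0}$ be the integer sequence defined by $G_0=0$, $G_1=1$, $G_{n+2}=mG_{n+1}+G_n$ for $n\geq 0$. Let $i\geq 1$ be an integer. For $j\in\mathbb{Z}$ put $$\varepsilon_i(j)=\bigl\lfloor \beta(j+G_i)\bigr\rfloor - \lfloor \beta j\rfloor - G_{i-1}.$$ Define $$U_i=\bigl\{kG_{i+1}+\lfloor k\beta\rfloor G_i \,\bigm|\, k\in\mathbb{Z},\ k\neq 0\bigr\}\ \cup\ \Bigl\{\tfrac{(-1)^i-1}{2}\,G_i\Bigr\}.$$ Then for every $j\in\mathbb{Z}$, $$\varepsilon_i(j)=\begin{cases}0 & \text{if } j\notin U_i,\\ (-1)^{i+1} & \text{if } j\in U_i.\end{cases}$$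
   Context: $\lfloor x\rfloor$ denotes the greatest integer not exceeding the real number $x$. -}

module Defs where

open import Data.Integer.Base as ℤ using (ℤ; 0ℤ; 1ℤ; -1ℤ; +_)
import Data.Integer.DivMod as ℤ
import Data.Integer.Properties as ℤ
open import Data.Nat.Base as ℕ using (ℕ; zero; suc; pred; _⊔_)
import Data.Nat.Properties as ℕ
open import Data.Product.Base using (∃; ∃-syntax; _×_; _,_)
open import Data.Rational.Base as ℚ using (ℚ; 0ℚ; 1ℚ; ½; ∣_∣; 1/_)
import Data.Rational.Properties as ℚ
open import Data.Rational.Solver using (module +-*-Solver)
open import Data.Sum.Base using (_⊎_)
open import Level using (0ℓ)
open import Relation.Binary.PropositionalEquality
open import Relation.Nullary.Negation using (¬_)
open import Relation.Unary using (Pred)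

-- Real numbers as Cauchy sequences of rationals, with _≈_ as equality.

record ℝ : Set where
  constructor mkℝ
  field
    seq    : ℕ → ℚ
    cauchy : ∀ ε → 0ℚ ℚ.< ε →
             ∃[ N ] ∀ p q → N ℕ.≤ p → N ℕ.≤ q → ∣ seq p ℚ.- seq q ∣ ℚ.< ε

open ℝ public

infix  4 _≈_ _<_ _≤_
infixl 6 _+_
infixl 7 _*_

_≈_ : ℝ → ℝ → Set
x ≈ y = ∀ ε → 0ℚ ℚ.< ε → ∃[ N ] ∀ n → N ℕ.≤ n → ∣ seq x n ℚ.- seq y n ∣ ℚ.< ε

-- The sequences must eventually stay apart by a fixed ε: a termwise strict
-- inequality would not separate the limits.
_<_ : ℝ → ℝ → Set
x < y = ∃[ ε ] 0ℚ ℚ.< ε × ∃[ N ] ∀ n → N ℕ.≤ n → seq x n ℚ.+ ε ℚ.≤ seq y n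

_≤_ : ℝ → ℝ → Set
x ≤ y = ¬ (y < x)

fromℚ : ℚ → ℝ
fromℚ r = mkℝ (λ _ → r) λ ε ε>0 → 0 , λ _ _ _ _ →
  subst (λ s → ∣ s ∣ ℚ.< ε) (sym (ℚ.+-inverseʳ r)) ε>0

fromℤ : ℤ → ℝ
fromℤ k = fromℚ (k ℚ./ 1)

0ℝ 1ℝ : ℝ
0ℝ = fromℤ 0ℤ
1ℝ = fromℤ 1ℤ

private
  open +-*-Solver

  sum-difference : ∀ a b c d →
    (a ℚ.+ b) ℚ.- (c ℚ.+ d) ≡ (a ℚ.- c) ℚ.+ (b ℚ.- d)
  sum-difference = solve 4 (λ a b c d →
    (a :+ b) :- (c :+ d) := (a :- c) :+ (b :- d)) refl

  product-difference : ∀ a b c d →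
    a ℚ.* b ℚ.- c ℚ.* d ≡ a ℚ.* (b ℚ.- d) ℚ.+ d ℚ.* (a ℚ.- c)
  product-difference = solve 4 (λ a b c d →
    a :* b :- c :* d := a :* (b :- d) :+ d :* (a :- c)) refl

  split-difference : ∀ a b → a ≡ (a ℚ.- b) ℚ.+ b
  split-difference = solve 2 (λ a b → a := (a :- b) :+ b) refl

  half-pos : ∀ ε → 0ℚ ℚ.< ε → 0ℚ ℚ.< ½ ℚ.* ε
  half-pos ε ε>0 = subst (ℚ._< ½ ℚ.* ε) (ℚ.*-zeroʳ ½) (ℚ.*-monoʳ-<-pos ½ ε>0)

  halves : ∀ ε → ½ ℚ.* ε ℚ.+ ½ ℚ.* ε ≡ ε
  halves = solve 1 (λ e → con ½ :* e :+ con ½ :* e := e) refl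

_+_ : ℝ → ℝ → ℝ
x + y = mkℝ (λ n → seq x n ℚ.+ seq y n) +-cauchy
  where
  +-cauchy : ∀ ε → 0ℚ ℚ.< ε → ∃[ N ] ∀ p q → N ℕ.≤ p → N ℕ.≤ q →
             ∣ (seq x p ℚ.+ seq y p) ℚ.- (seq x q ℚ.+ seq y q) ∣ ℚ.< ε
  +-cauchy ε ε>0
    with ½ε>0 ← half-pos ε ε>0
    with M , hx ← cauchy x (½ ℚ.* ε) ½ε>0
    with N , hy ← cauchy y (½ ℚ.* ε) ½ε>0
    = M ⊔ N , λ p q hp hq → begin-strict
      ∣ (seq x p ℚ.+ seq y p) ℚ.- (seq x q ℚ.+ seq y q) ∣
        ≡⟨ cong ∣_∣ (sum-difference (seq x p) (seq y p) (seq x q) (seq y q)) ⟩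
      ∣ (seq x p ℚ.- seq x q) ℚ.+ (seq y p ℚ.- seq y q) ∣
        ≤⟨ ℚ.∣p+q∣≤∣p∣+∣q∣ (seq x p ℚ.- seq x q) (seq y p ℚ.- seq y q) ⟩
      ∣ seq x p ℚ.- seq x q ∣ ℚ.+ ∣ seq y p ℚ.- seq y q ∣
        <⟨ ℚ.+-mono-< (hx p q (ℕ.m⊔n≤o⇒m≤o M N hp) (ℕ.m⊔n≤o⇒m≤o M N hq))
                      (hy p q (ℕ.m⊔n≤o⇒n≤o M N hp) (ℕ.m⊔n≤o⇒n≤o M N hq)) ⟩
      ½ ℚ.* ε ℚ.+ ½ ℚ.* ε
        ≡⟨ halves ε ⟩
      ε ∎
    where open ℚ.≤-Reasoning

eventually-bounded : ∀ x → ∃[ B ] ℚ.Positive B ×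
                     ∃[ N ] ∀ n → N ℕ.≤ n → ∣ seq x n ∣ ℚ.≤ B
eventually-bounded x
  with N , h ← cauchy x 1ℚ (ℚ.positive⁻¹ 1ℚ)
  = 1ℚ ℚ.+ ∣ seq x N ∣
  , ℚ.positive (ℚ.+-mono-<-≤ (ℚ.positive⁻¹ 1ℚ) (ℚ.0≤∣p∣ (seq x N)))
  , N , λ n N≤n → begin
    ∣ seq x n ∣
      ≡⟨ cong ∣_∣ (split-difference (seq x n) (seq x N)) ⟩
    ∣ (seq x n ℚ.- seq x N) ℚ.+ seq x N ∣
      ≤⟨ ℚ.∣p+q∣≤∣p∣+∣q∣ (seq x n ℚ.- seq x N) (seq x N) ⟩
    ∣ seq x n ℚ.- seq x N ∣ ℚ.+ ∣ seq x N ∣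
      ≤⟨ ℚ.+-monoˡ-≤ ∣ seq x N ∣ (ℚ.<⇒≤ (h n N N≤n ℕ.≤-refl)) ⟩
    1ℚ ℚ.+ ∣ seq x N ∣ ∎
  where open ℚ.≤-Reasoning

private
  split-ε : ∀ A B ε .{{_ : ℚ.Positive A}} .{{_ : ℚ.Positive B}} → 0ℚ ℚ.< ε →
            ∃[ δ ] 0ℚ ℚ.< δ × A ℚ.* δ ℚ.+ B ℚ.* δ ≡ ε
  split-ε A B ε ε>0 = go (A ℚ.+ B) {{ℚ.pos+pos⇒pos A B}} refl
    where
    go : ∀ C .{{_ : ℚ.Positive C}} → A ℚ.+ B ≡ C →
         ∃[ δ ] 0ℚ ℚ.< δ × A ℚ.* δ ℚ.+ B ℚ.* δ ≡ ε
    go C A+B≡C = D ℚ.* ε , δ>0 , (begin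
      A ℚ.* (D ℚ.* ε) ℚ.+ B ℚ.* (D ℚ.* ε) ≡⟨ ℚ.*-distribʳ-+ (D ℚ.* ε) A B ⟨
      (A ℚ.+ B) ℚ.* (D ℚ.* ε)             ≡⟨ cong (ℚ._* (D ℚ.* ε)) A+B≡C ⟩
      C ℚ.* (D ℚ.* ε)                     ≡⟨ ℚ.*-assoc C D ε ⟨
      C ℚ.* D ℚ.* ε                       ≡⟨ cong (ℚ._* ε) (ℚ.*-inverseʳ C) ⟩
      1ℚ ℚ.* ε                            ≡⟨ ℚ.*-identityˡ ε ⟩
      ε                                   ∎)
      where
      open ≡-Reasoning
      instance
        C-nonZero : ℚ.NonZero C
        C-nonZero = ℚ.pos⇒nonZero C
      D : ℚ
      D = 1/ C
      δ>0 : 0ℚ ℚ.< D ℚ.* ε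
      δ>0 = ℚ.positive⁻¹ (D ℚ.* ε)
              {{ℚ.pos*pos⇒pos D {{ℚ.1/pos⇒pos C}} ε {{ℚ.positive ε>0}}}}

  product-< : ∀ C δ s t .{{_ : ℚ.Positive C}} →
              ∣ s ∣ ℚ.≤ C → ∣ t ∣ ℚ.< δ → ∣ s ℚ.* t ∣ ℚ.< C ℚ.* δ
  product-< C δ s t s≤C t<δ = begin-strict
    ∣ s ℚ.* t ∣     ≡⟨ ℚ.∣p*q∣≡∣p∣*∣q∣ s t ⟩
    ∣ s ∣ ℚ.* ∣ t ∣ ≤⟨ ℚ.*-monoʳ-≤-nonNeg ∣ t ∣ {{ℚ.∣-∣-nonNeg t}} s≤C ⟩
    C ℚ.* ∣ t ∣     <⟨ ℚ.*-monoʳ-<-pos C t<δ ⟩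
    C ℚ.* δ         ∎
    where open ℚ.≤-Reasoning

  product-close : ∀ A B δ a b c d .{{_ : ℚ.Positive A}} .{{_ : ℚ.Positive B}} →
    ∣ a ∣ ℚ.≤ A → ∣ d ∣ ℚ.≤ B → ∣ a ℚ.- c ∣ ℚ.< δ → ∣ b ℚ.- d ∣ ℚ.< δ →
    ∣ a ℚ.* b ℚ.- c ℚ.* d ∣ ℚ.< A ℚ.* δ ℚ.+ B ℚ.* δ
  product-close A B δ a b c d a≤A d≤B ac<δ bd<δ = begin-strict
    ∣ a ℚ.* b ℚ.- c ℚ.* d ∣
      ≡⟨ cong ∣_∣ (product-difference a b c d) ⟩
    ∣ a ℚ.* (b ℚ.- d) ℚ.+ d ℚ.* (a ℚ.- c) ∣
      ≤⟨ ℚ.∣p+q∣≤∣p∣+∣q∣ (a ℚ.* (b ℚ.- d)) (d ℚ.* (a ℚ.- c)) ⟩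
    ∣ a ℚ.* (b ℚ.- d) ∣ ℚ.+ ∣ d ℚ.* (a ℚ.- c) ∣
      <⟨ ℚ.+-mono-< (product-< A δ a (b ℚ.- d) a≤A bd<δ)
                    (product-< B δ d (a ℚ.- c) d≤B ac<δ) ⟩
    A ℚ.* δ ℚ.+ B ℚ.* δ ∎
    where open ℚ.≤-Reasoning

_*_ : ℝ → ℝ → ℝ
x * y = mkℝ (λ n → seq x n ℚ.* seq y n) *-cauchy
  where
  *-cauchy : ∀ ε → 0ℚ ℚ.< ε → ∃[ N ] ∀ p q → N ℕ.≤ p → N ℕ.≤ q →
             ∣ seq x p ℚ.* seq y p ℚ.- seq x q ℚ.* seq y q ∣ ℚ.< ε
  *-cauchy ε ε>0 =
      let A , A>0 , K , bx = eventually-bounded x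
          B , B>0 , L , by = eventually-bounded y
          δ , δ>0 , Aδ+Bδ≡ε = split-ε A B ε {{A>0}} {{B>0}} ε>0
          M , hx = cauchy x δ δ>0
          N , hy = cauchy y δ δ>0
      in (K ⊔ L) ⊔ (M ⊔ N) , λ p q hp hq →
      let pKL = ℕ.m⊔n≤o⇒m≤o (K ⊔ L) (M ⊔ N) hp
          pMN = ℕ.m⊔n≤o⇒n≤o (K ⊔ L) (M ⊔ N) hp
          qKL = ℕ.m⊔n≤o⇒m≤o (K ⊔ L) (M ⊔ N) hq
          qMN = ℕ.m⊔n≤o⇒n≤o (K ⊔ L) (M ⊔ N) hq
      in subst (∣ seq x p ℚ.* seq y p ℚ.- seq x q ℚ.* seq y q ∣ ℚ.<_) Aδ+Bδ≡ε
           (product-close A B δ (seq x p) (seq y p) (seq x q) (seq y q)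
             {{A>0}} {{B>0}}
             (bx p (ℕ.m⊔n≤o⇒m≤o K L pKL))
             (by q (ℕ.m⊔n≤o⇒n≤o K L qKL))
             (hx p q (ℕ.m⊔n≤o⇒m≤o M N pMN) (ℕ.m⊔n≤o⇒m≤o M N qMN))
             (hy p q (ℕ.m⊔n≤o⇒n≤o M N pMN) (ℕ.m⊔n≤o⇒n≤o M N qMN)))

-- ⌊ x ⌋ = n as a relation: there is constructively no total floor function
-- ℝ → ℤ respecting _≈_, so floors of particular reals need an existence proof.
IsFloor : ℝ → ℤ → Set
IsFloor x n = fromℤ n ≤ x × (∀ z → fromℤ z ≤ x → z ℤ.≤ n)

IsFloor-unique : ∀ {x n n′} → IsFloor x n → IsFloor x n′ → n ≡ n′
IsFloor-unique {n = n} {n′} (n≤x , n-max) (n′≤x , n′-max) =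
  ℤ.≤-antisym (n′-max n n≤x) (n-max n′ n′≤x)

G : ℕ → ℕ → ℤ
G m zero          = 0ℤ
G m (suc zero)    = 1ℤ
G m (suc (suc n)) = + m ℤ.* G m (suc n) ℤ.+ G m n

-- Below, ⌊β·_⌋ stands for the function k ↦ ⌊ β k ⌋ on the integers; `pred i`
-- is i - 1 only for i ≥ 1.

ε : (m : ℕ) (⌊β·_⌋ : ℤ → ℤ) (i : ℕ) → ℤ → ℤ
ε m ⌊β·_⌋ i j = ⌊β· j ℤ.+ G m i ⌋ ℤ.- ⌊β· j ⌋ ℤ.- G m (pred i)

-- The integer division by 2 is exact, (-1)ⁱ - 1 being 0 or -2.
U : (m : ℕ) (⌊β·_⌋ : ℤ → ℤ) (i : ℕ) → Pred ℤ 0ℓ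
U m ⌊β·_⌋ i j =
    (∃[ k ] k ≢ 0ℤ × j ≡ k ℤ.* G m (suc i) ℤ.+ ⌊β· k ⌋ ℤ.* G m i)
  ⊎ j ≡ ((-1ℤ ℤ.^ i ℤ.- 1ℤ) ℤ./ + 2) ℤ.* G m i

module Submission where

-- Put s = (-1)ⁱ. The map (k , l) ↦ (j , n) = (k G (i + 1) + l G i , k G i + l G (i - 1))
-- is a bijection of ℤ × ℤ with j β - n = s βⁱ (k β - l), and (0 , 1) ↦ (G i , G (i - 1)).
-- Hence passing from j to j + G i amounts to replacing l by l + 1, and ε i j ≢ 0 exactly
-- when 0 lies between k β - l - 1 and k β - l, that is, when l = ⌊ k β ⌋. For k = 0 one of
-- the two values is 0, and which of them counts depends on s: this gives the last element
-- of U i. The only order facts needed are signs in ℤ[β], which the Euclidean algorithm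
-- decides.

import Defs
open import Data.Empty using (⊥-elim)
open import Data.Integer.Base as ℤ using (ℤ; +_; -[1+_]; 0ℤ; 1ℤ; -1ℤ; _^_)
import Data.Integer.Properties as ℤ
import Data.Integer.Solver as ℤ-Solver
open import Data.Nat.Base as ℕ using (ℕ; zero; suc; _⊔_)
import Data.Nat.Properties as ℕ
open import Data.Product.Base using (Σ-syntax; ∃-syntax; _×_; _,_; proj₁; proj₂)
open import Data.Rational.Base
  using (ℚ; 0ℚ; 1ℚ; ½; ∣_∣; NonZero; Positive; positive; nonNegative; _/_; 1/_; toℚᵘ; fromℚᵘ)
import Data.Rational.Properties as ℚ
import Data.Rational.Solver as ℚ-Solver
import Data.Rational.Unnormalised.Base as ℚᵘ
import Data.Rational.Unnormalised.Properties as ℚᵘ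
open import Data.Sum.Base using (_⊎_; inj₁; inj₂)
open import Relation.Binary.PropositionalEquality
open import Relation.Nullary using (¬_; yes; no)
open import Relation.Unary using (_∈_; _∉_)

-- Signs of the elements of ℤ[β], from an abstract positivity predicate.

-- Pos k l stands for k β - l > 0.
module Positivity
  (m : ℕ) (1≤m : 1 ℕ.≤ m)
  (Pos : ℤ → ℤ → Set)
  (pos-+ : ∀ {k l k′ l′} → Pos k l → Pos k′ l′ → Pos (k ℤ.+ k′) (l ℤ.+ l′))
  -- Multiplication by β: since β² = 1 - m β, β (k β - l) = k - (m k + l) β.
  (pos-β* : ∀ {k l} → Pos k l → Pos (ℤ.- (+ m ℤ.* k ℤ.+ l)) (ℤ.- k))
  (pos-irrefl : ¬ Pos 0ℤ 0ℤ)
  (pos-1 : Pos 0ℤ -1ℤ)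
  (pos-β : Pos 1ℤ 0ℤ)
  where

  open import Data.Integer.Base using (_+_; _*_; _-_; -_; _≤_; _<_)
  open ℤ-Solver.+-*-Solver

  cast : ∀ {k l k′ l′} → k ≡ k′ → l ≡ l′ → Pos k l → Pos k′ l′
  cast = subst₂ Pos

  -- A negation, to match `_≤_` on the reals, which is the negated reverse strict order.
  NonNeg : ℤ → ℤ → Set
  NonNeg k l = ¬ Pos (- k) (- l)

  pos⇒nonNeg : ∀ {k l} → Pos k l → NonNeg k l
  pos⇒nonNeg {k} {l} p q =
    pos-irrefl (cast (ℤ.+-inverseʳ k) (ℤ.+-inverseʳ l) (pos-+ p q))

  pos-−ℕ : ∀ n → Pos 0ℤ -[1+ n ]
  pos-−ℕ zero    = pos-1
  pos-−ℕ (suc n) = pos-+ pos-1 (pos-−ℕ n)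

  pos-ℕβ : ∀ n → Pos (+ suc n) 0ℤ
  pos-ℕβ zero    = pos-β
  pos-ℕβ (suc n) = pos-+ pos-β (pos-ℕβ n)

  pos-ℕβ+ℕ : ∀ a b → Pos (+ suc a) (- (+ b))
  pos-ℕβ+ℕ a zero    = pos-ℕβ a
  pos-ℕβ+ℕ a (suc b) = cast (ℤ.+-identityʳ _) (ℤ.+-identityˡ _)
    (pos-+ (pos-ℕβ a) (pos-−ℕ b))

  pos-0⇒<0 : ∀ {l} → Pos 0ℤ l → l < 0ℤ
  pos-0⇒<0 {+ zero}   p = ⊥-elim (pos-irrefl p)
  pos-0⇒<0 {+ suc n}  p = ⊥-elim (pos⇒nonNeg p (pos-−ℕ n))
  pos-0⇒<0 { -[1+ n ]} p = ℤ.-<+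

  -- A step of the Euclidean algorithm: c β - (a + 1) = - β ((a + 1) β - (c - m (a + 1))),
  -- which is negative if c ≤ m (a + 1).
  pos-descent : ∀ n a c → c ℕ.≤ n →
    Pos (+ c) (+ suc a) ⊎ Pos (- (+ c)) (- (+ suc a))
  pos-descent n a c c≤n with ℕ.≤-<-connex c (m ℕ.* suc a)
  ... | inj₁ c≤ma with e , ma≡c+e ← ℕ.m≤n⇒∃[o]m+o≡n c≤ma = inj₂
    (cast (trans (cong (λ x → - (x - + e))
                    (trans (sym (ℤ.pos-* m (suc a))) (cong +_ (sym ma≡c+e))))
                 (solve 2 (λ c e → :- (c :+ e :- e) := :- c) refl (+ c) (+ e)))
          refl (pos-β* (pos-ℕβ+ℕ a e)))
  pos-descent zero a c c≤n | inj₂ ma<c with () ← ℕ.<-≤-trans ma<c c≤n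
  pos-descent (suc n) a c c≤n | inj₂ ma<c
    with d , ma+d≡c ← ℕ.m≤n⇒∃[o]m+o≡n ma<c
    -- The bound n can drop because m ≥ 1 gives a + 1 ≤ m (a + 1) < c. Each step reverses the sign.
    with pos-descent n d (suc a) (ℕ.≤-trans (ℕ.m≤n*m (suc a) m {{ℕ.>-nonZero 1≤m}})
                                  (ℕ.≤-pred (ℕ.≤-trans ma<c c≤n)))
  ... | p = go p
    where
    c≡ : + m * + suc a + + suc d ≡ + c
    c≡ = trans (cong (_+ + suc d) (sym (ℤ.pos-* m (suc a))))
               (cong +_ (trans (ℕ.+-suc _ d) ma+d≡c))
    go : Pos (+ suc a) (+ suc d) ⊎ Pos (- (+ suc a)) (- (+ suc d)) →
         Pos (+ c) (+ suc a) ⊎ Pos (- (+ c)) (- (+ suc a))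
    go (inj₁ p) = inj₂ (cast (cong -_ c≡) refl (pos-β* p))
    go (inj₂ p) = inj₁ (cast
      (trans (solve 3 (λ m a d → :- (m :* :- a :+ :- d) := m :* a :+ d) refl
                (+ m) (+ suc a) (+ suc d)) c≡)
      refl (pos-β* p))

  -- The case `zero` asks for k = l = 0, so a value of `Sign` for every pair also contains the
  -- irrationality of β.
  data Sign (k l : ℤ) : Set where
    pos  : Pos k l → Sign k l
    zero : k ≡ 0ℤ → l ≡ 0ℤ → Sign k l
    neg  : Pos (- k) (- l) → Sign k l

  -- Only coordinates that are both positive or both negative need the descent.
  sign : ∀ k l → Sign k l
  sign (+ zero)  (+ zero)  = zero refl refl
  sign (+ zero)  (+ suc b) = neg (pos-−ℕ b)
  sign (+ zero)  -[1+ b ]  = pos (pos-−ℕ b)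
  sign (+ suc a) (+ zero)  = pos (pos-ℕβ a)
  sign (+ suc a) -[1+ b ]  = pos (pos-ℕβ+ℕ a (suc b))
  sign -[1+ a ]  (+ b)     = neg (pos-ℕβ+ℕ a b)
  sign (+ suc a) (+ suc b) with pos-descent (suc a) b (suc a) ℕ.≤-refl
  ... | inj₁ p = pos p
  ... | inj₂ p = neg p
  sign -[1+ a ]  -[1+ b ]  with pos-descent (suc a) b (suc a) ℕ.≤-refl
  ... | inj₁ p = neg p
  ... | inj₂ p = pos p

  nonNeg? : ∀ k l → NonNeg k l ⊎ Pos (- k) (- l)
  nonNeg? k l with sign k l
  ... | pos p          = inj₁ (pos⇒nonNeg p)
  ... | zero refl refl = inj₁ pos-irrefl
  ... | neg p          = inj₂ p

  pos+nonNeg : ∀ {k l k′ l′} → Pos k l → NonNeg k′ l′ → Pos (k + k′) (l + l′)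
  pos+nonNeg {k} {l} {k′} {l′} p q with sign k′ l′
  ... | pos p′         = pos-+ p p′
  ... | zero refl refl = cast (sym (ℤ.+-identityʳ k)) (sym (ℤ.+-identityʳ l)) p
  ... | neg p′         = ⊥-elim (q p′)

  -- Irrationality of β: k β = l forces k = 0.
  nonNeg⇒pos : ∀ {k l} → k ≢ 0ℤ → NonNeg k l → Pos k l
  nonNeg⇒pos {k} {l} k≢0 q with sign k l
  ... | pos p      = p
  ... | zero k≡0 _ = ⊥-elim (k≢0 k≡0)
  ... | neg p      = ⊥-elim (q p)

  ≤kβ<⇒< : ∀ {k l l′} → NonNeg k l → Pos (- k) (- l′) → l < l′
  ≤kβ<⇒< {k} {l} {l′} q p = subst₂ _<_
    (solve 2 (λ l l′ → :- l′ :+ l :+ l′ := l) refl l l′) (ℤ.+-identityˡ l′)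
    (ℤ.+-monoˡ-< l′ (pos-0⇒<0 (cast (ℤ.+-inverseˡ k) refl (pos+nonNeg p q))))

  -- 1 - β = β (β + (m - 1)), a product of positive factors.
  pos-1-β : Pos -1ℤ -1ℤ
  pos-1-β with m′ , 1+m′≡m ← ℕ.m≤n⇒∃[o]m+o≡n 1≤m = cast
    (trans (cong (λ x → - (+ x * 1ℤ - + m′)) (sym 1+m′≡m))
      (solve 1 (λ x → :- ((con 1ℤ :+ x) :* con 1ℤ :- x) := con -1ℤ) refl (+ m′)))
    refl (pos-β* (pos-ℕβ+ℕ 0 m′))

  -- Floors of integer multiples of β.

  Floor : ℤ → ℤ → Set
  Floor k l = NonNeg k l × Pos (- k) (- (l + 1ℤ))

  <+1⇒≤ : ∀ {a b} → a < b + 1ℤ → a ≤ b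
  <+1⇒≤ {a} {b} a<b+1 = subst (a ≤_)
    (solve 1 (λ b → con -1ℤ :+ (b :+ con 1ℤ) := b) refl b) (ℤ.i<j⇒i≤pred[j] a<b+1)

  floor-unique : ∀ {k l l′} → Floor k l → Floor k l′ → l ≡ l′
  floor-unique {k} (lo , hi) (lo′ , hi′) =
    ℤ.≤-antisym (<+1⇒≤ (≤kβ<⇒< {k} lo hi′)) (<+1⇒≤ (≤kβ<⇒< {k} lo′ hi))

  -- Since 0 < β < 1, adding β raises the floor by 0 or 1; the sign at l + 1 tells which.
  floor-ℕ : ∀ n → ∃[ l ] Floor (+ n) l
  floor-ℕ zero    = 0ℤ , pos-irrefl , pos-1
  floor-ℕ (suc n) with l , lo , hi ← floor-ℕ n with sign (+ suc n) (l + 1ℤ)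
  ... | neg p = l
    , pos⇒nonNeg (cast refl (ℤ.+-identityˡ l) (pos+nonNeg pos-β lo))
    , p
  ... | pos p = l + 1ℤ
    , pos⇒nonNeg p
    , cast (solve 1 (λ n → :- n :- con 1ℤ := :- (con 1ℤ :+ n)) refl (+ n))
           (solve 1 (λ l → :- (l :+ con 1ℤ) :- con 1ℤ := :- (l :+ con 1ℤ :+ con 1ℤ)) refl l)
           (pos-+ hi pos-1-β)

  floor : ∀ k → ∃[ l ] Floor k l
  floor (+ n)    = floor-ℕ n
  -- ⌊-x⌋ = -(⌊x⌋ + 1), because x = (n + 1) β is not an integer.
  floor -[1+ n ] with l , lo , hi ← floor-ℕ (suc n) = - (l + 1ℤ)
    , pos⇒nonNeg hi
    , cast refl (solve 1 (λ l → l := :- (:- (l :+ con 1ℤ) :+ con 1ℤ)) refl l)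
        (nonNeg⇒pos {+ suc n} {l} (λ ()) lo)

  ⌊β·_⌋ : ℤ → ℤ
  ⌊β· k ⌋ = proj₁ (floor k)

  floor-≡ : ∀ {k l} → Floor k l → ⌊β· k ⌋ ≡ l
  floor-≡ {k} = floor-unique {k} (proj₂ (floor k))

  -- Multiplication by powers of β in terms of the sequence G.

  -- β G (i + 1) - G i = (-1)ⁱ β ^ (i + 1)
  pos-1-βⁱ : ∀ i → let s = -1ℤ ^ suc i in
    Pos (s * Defs.G m (suc i)) (s * Defs.G m i - 1ℤ)
  pos-1-βⁱ zero    = pos-1-β
  -- 1 - β ^ (i + 2) = β (1 - β ^ (i + 1)) + (1 - β).
  pos-1-βⁱ (suc i) = cast
    (solve 4 (λ s m g g′ → :- (m :* (s :* g′) :+ (s :* g :- con 1ℤ)) :- con 1ℤ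
                           := con -1ℤ :* s :* (m :* g′ :+ g)) refl s (+ m) g g′)
    (solve 2 (λ s g′ → :- (s :* g′) :- con 1ℤ := con -1ℤ :* s :* g′ :- con 1ℤ) refl s g′)
    (pos-+ (pos-β* (pos-1-βⁱ i)) pos-1-β)
    where
    s  = -1ℤ ^ suc i
    g  = Defs.G m i
    g′ = Defs.G m (suc i)

  -- For the j and n built from k and l, s (j β - n) = β ^ (i + 1) (k β - l). The induction
  -- multiplies by β once and then by β ^ i in the same form.
  pos-βⁱ* : ∀ i k l → Pos k l → let s = -1ℤ ^ suc i in
    Pos (s * (k * Defs.G m (suc (suc i)) + l * Defs.G m (suc i)))
        (s * (k * Defs.G m (suc i) + l * Defs.G m i))
  pos-βⁱ* zero k l p = cast
    (solve 3 (λ m k l → :- (m :* k :+ l)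
        := con -1ℤ :* (k :* (m :* con 1ℤ :+ con 0ℤ) :+ l :* con 1ℤ)) refl (+ m) k l)
    (solve 2 (λ k l → :- k := con -1ℤ :* (k :* con 1ℤ :+ l :* con 0ℤ)) refl k l)
    (pos-β* p)
  pos-βⁱ* (suc i) k l p = cast (step g′ g″) (step g g′)
    (pos-βⁱ* i (- (+ m * k + l)) (- k) (pos-β* p))
    where
    s  = -1ℤ ^ suc i
    g  = Defs.G m i
    g′ = Defs.G m (suc i)
    g″ = Defs.G m (suc (suc i))
    step : ∀ x y → s * (- (+ m * k + l) * y + - k * x) ≡
                   -1ℤ * s * (k * (+ m * y + x) + l * y)
    step = solve 6 (λ s m k l x y → s :* (:- (m :* k :+ l) :* y :+ :- k :* x)
      := con -1ℤ :* s :* (k :* (m :* y :+ x) :+ l :* y)) refl s (+ m) k l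

  -- The matrix of the map has determinant ±1. Raising the index turns a solution (k , l) into (l ,
  -- k - m l), by the recurrence for G.
  G-surjective : ∀ i j n → ∃[ k ] ∃[ l ]
    j ≡ k * Defs.G m (suc (suc i)) + l * Defs.G m (suc i) ×
    n ≡ k * Defs.G m (suc i) + l * Defs.G m i
  G-surjective zero j n = n , j - + m * n
    , solve 3 (λ m j n → j := n :* (m :* con 1ℤ :+ con 0ℤ) :+ (j :- m :* n) :* con 1ℤ)
        refl (+ m) j n
    , solve 3 (λ m j n → n := n :* con 1ℤ :+ (j :- m :* n) :* con 0ℤ) refl (+ m) j n
  G-surjective (suc i) j n with k , l , j≡ , n≡ ← G-surjective i j n =
    l , k - + m * l
    , trans j≡ (step (Defs.G m (suc i)) (Defs.G m (suc (suc i))))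
    , trans n≡ (step (Defs.G m i) (Defs.G m (suc i)))
    where
    step : ∀ x y → k * y + l * x ≡ l * (+ m * y + x) + (k - + m * l) * y
    step = solve 5 (λ m k l x y → k :* y :+ l :* x
      := l :* (m :* y :+ x) :+ (k :- m :* l) :* y) refl (+ m) k l

  nonNeg-βⁱ* : ∀ i k l → NonNeg k l → let s = -1ℤ ^ suc i in
    NonNeg (s * (k * Defs.G m (suc (suc i)) + l * Defs.G m (suc i)))
           (s * (k * Defs.G m (suc i) + l * Defs.G m i))
  nonNeg-βⁱ* i k l q with sign k l
  ... | pos p = pos⇒nonNeg (pos-βⁱ* i k l p)
  ... | zero refl refl = subst₂ NonNeg (sym (ℤ.*-zeroʳ s)) (sym (ℤ.*-zeroʳ s)) pos-irrefl
    where s = -1ℤ ^ suc i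
  ... | neg p = ⊥-elim (q p)

  -- Floors of β j and β (j + G i), by the parity of i.

  -- With j = k g″ + l g′ and n = k g′ + l g, j β - n is βⁱ (k β - l) here, -βⁱ (k β - l) in Odd.
  module Even (g g′ g″ : ℤ)
    (pos-scale : ∀ k l → Pos k l → Pos (1ℤ * (k * g″ + l * g′)) (1ℤ * (k * g′ + l * g)))
    (nonNeg-scale : ∀ k l → NonNeg k l → NonNeg (1ℤ * (k * g″ + l * g′)) (1ℤ * (k * g′ + l * g)))
    (pos-1-scale : Pos (1ℤ * g′) (1ℤ * g - 1ℤ))
    where

    -- From 0 ≤ k β - l < 1 follows 0 ≤ j β - n < 1, the upper bound because 1 - βⁱ (k β - l) = βⁱ
    -- (l + 1 - k β) + (1 - βⁱ).
    floor-J : ∀ k l → Floor k l → Floor (k * g″ + l * g′) (k * g′ + l * g)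
    floor-J k l (lo , hi) = lo′ , hi′
      where
      lo′ : NonNeg (k * g″ + l * g′) (k * g′ + l * g)
      lo′ = subst₂ NonNeg (ℤ.*-identityˡ _) (ℤ.*-identityˡ _) (nonNeg-scale k l lo)
      hi′ : Pos (- (k * g″ + l * g′)) (- (k * g′ + l * g + 1ℤ))
      hi′ = cast
        (solve 4 (λ k l x y → con 1ℤ :* (:- k :* y :+ :- (l :+ con 1ℤ) :* x) :+ con 1ℤ :* x
          := :- (k :* y :+ l :* x)) refl k l g′ g″)
        (solve 4 (λ k l x y → con 1ℤ :* (:- k :* y :+ :- (l :+ con 1ℤ) :* x) :+ (con 1ℤ :* x :- con 1ℤ)
          := :- (k :* y :+ l :* x :+ con 1ℤ)) refl k l g g′)
        (pos-+ (pos-scale _ _ hi) pos-1-scale)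

    -- Replacing l by l + 1 makes the remainder βⁱ (k β - l - 1) negative but above -1, so the floor
    -- drops by one.
    floor-J+G∈ : ∀ k l → Floor k l →
      Floor (k * g″ + l * g′ + g′) (k * g′ + l * g + (g + -1ℤ))
    floor-J+G∈ k l (lo , hi) = lo′ , hi′
      where
      lo′ : NonNeg (k * g″ + l * g′ + g′) (k * g′ + l * g + (g + -1ℤ))
      lo′ = pos⇒nonNeg (cast
        (solve 4 (λ k l x y → con 1ℤ :* x :+ con 1ℤ :* (k :* y :+ l :* x)
          := k :* y :+ l :* x :+ x) refl k l g′ g″)
        (solve 4 (λ k l x y → con 1ℤ :* x :- con 1ℤ :+ con 1ℤ :* (k :* y :+ l :* x)
          := k :* y :+ l :* x :+ (x :+ con -1ℤ)) refl k l g g′)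
        (pos+nonNeg pos-1-scale (nonNeg-scale k l lo)))
      hi′ : Pos (- (k * g″ + l * g′ + g′)) (- (k * g′ + l * g + (g + -1ℤ) + 1ℤ))
      hi′ = cast
        (solve 4 (λ k l x y → con 1ℤ :* (:- k :* y :+ :- (l :+ con 1ℤ) :* x)
          := :- (k :* y :+ l :* x :+ x)) refl k l g′ g″)
        (solve 4 (λ k l x y → con 1ℤ :* (:- k :* y :+ :- (l :+ con 1ℤ) :* x)
          := :- (k :* y :+ l :* x :+ (x :+ con -1ℤ) :+ con 1ℤ)) refl k l g g′)
        (pos-scale _ _ hi)

    -- The remainder loses βⁱ > 0, so it stays below 1; it stays nonnegative because l + 1 ≤ k β.
    floor-J+G∉ : ∀ k l → NonNeg k (l + 1ℤ) →
      Floor (k * g″ + l * g′) (k * g′ + l * g) →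
      Floor (k * g″ + l * g′ + g′) (k * g′ + l * g + (g + 0ℤ))
    floor-J+G∉ k l q (_ , hi) = lo′ , hi′
      where
      lo′ : NonNeg (k * g″ + l * g′ + g′) (k * g′ + l * g + (g + 0ℤ))
      lo′ = subst₂ NonNeg
        (solve 4 (λ k l x y → con 1ℤ :* (k :* y :+ (l :+ con 1ℤ) :* x)
          := k :* y :+ l :* x :+ x) refl k l g′ g″)
        (solve 4 (λ k l x y → con 1ℤ :* (k :* y :+ (l :+ con 1ℤ) :* x)
          := k :* y :+ l :* x :+ (x :+ con 0ℤ)) refl k l g g′)
        (nonNeg-scale _ _ q)
      hi′ : Pos (- (k * g″ + l * g′ + g′)) (- (k * g′ + l * g + (g + 0ℤ) + 1ℤ))
      hi′ = cast
        (solve 4 (λ k l x y → :- (k :* y :+ l :* x) :+ con 1ℤ :* (con 0ℤ :* y :+ con -1ℤ :* x)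
          := :- (k :* y :+ l :* x :+ x)) refl k l g′ g″)
        (solve 4 (λ k l x y → :- (k :* y :+ l :* x :+ con 1ℤ) :+ con 1ℤ :* (con 0ℤ :* y :+ con -1ℤ :* x)
          := :- (k :* y :+ l :* x :+ (x :+ con 0ℤ) :+ con 1ℤ)) refl k l g g′)
        (pos-+ hi (pos-scale 0ℤ -1ℤ pos-1))

  module Odd (g g′ g″ : ℤ)
    (pos-scale : ∀ k l → Pos k l → Pos (-1ℤ * (k * g″ + l * g′)) (-1ℤ * (k * g′ + l * g)))
    (nonNeg-scale : ∀ k l → NonNeg k l → NonNeg (-1ℤ * (k * g″ + l * g′)) (-1ℤ * (k * g′ + l * g)))
    (pos-1-scale : Pos (-1ℤ * g′) (-1ℤ * g - 1ℤ))
    where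

    -- The scaling now reverses the order, so the half-open interval is 0 < k β - l ≤ 1 and the
    -- floor is n - 1. The pair (0 , -1) satisfies this, and (0 , 0) does not.
    floor-J : ∀ k l → Pos k l → NonNeg (- k) (- (l + 1ℤ)) →
      Floor (k * g″ + l * g′) (k * g′ + l * g - 1ℤ)
    floor-J k l p q = lo′ , hi′
      where
      lo′ : NonNeg (k * g″ + l * g′) (k * g′ + l * g - 1ℤ)
      lo′ = pos⇒nonNeg (cast
        (solve 4 (λ k l x y → con -1ℤ :* x :+ con -1ℤ :* (:- k :* y :+ :- (l :+ con 1ℤ) :* x)
          := k :* y :+ l :* x) refl k l g′ g″)
        (solve 4 (λ k l x y → con -1ℤ :* x :- con 1ℤ :+ con -1ℤ :* (:- k :* y :+ :- (l :+ con 1ℤ) :* x)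
          := k :* y :+ l :* x :- con 1ℤ) refl k l g g′)
        (pos+nonNeg pos-1-scale (nonNeg-scale _ _ q)))
      hi′ : Pos (- (k * g″ + l * g′)) (- (k * g′ + l * g - 1ℤ + 1ℤ))
      hi′ = cast
        (solve 4 (λ k l x y → con -1ℤ :* (k :* y :+ l :* x)
          := :- (k :* y :+ l :* x)) refl k l g′ g″)
        (solve 4 (λ k l x y → con -1ℤ :* (k :* y :+ l :* x)
          := :- (k :* y :+ l :* x :- con 1ℤ :+ con 1ℤ)) refl k l g g′)
        (pos-scale _ _ p)

    -- The new remainder βⁱ (l + 1 - k β) is no longer negative, so the floor gains one.
    floor-J+G∈ : ∀ k l → Pos k l → NonNeg (- k) (- (l + 1ℤ)) →
      Floor (k * g″ + l * g′ + g′) (k * g′ + l * g - 1ℤ + (g + 1ℤ))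
    floor-J+G∈ k l p q = lo′ , hi′
      where
      lo′ : NonNeg (k * g″ + l * g′ + g′) (k * g′ + l * g - 1ℤ + (g + 1ℤ))
      lo′ = subst₂ NonNeg
        (solve 4 (λ k l x y → con -1ℤ :* (:- k :* y :+ :- (l :+ con 1ℤ) :* x)
          := k :* y :+ l :* x :+ x) refl k l g′ g″)
        (solve 4 (λ k l x y → con -1ℤ :* (:- k :* y :+ :- (l :+ con 1ℤ) :* x)
          := k :* y :+ l :* x :- con 1ℤ :+ (x :+ con 1ℤ)) refl k l g g′)
        (nonNeg-scale _ _ q)
      hi′ : Pos (- (k * g″ + l * g′ + g′)) (- (k * g′ + l * g - 1ℤ + (g + 1ℤ) + 1ℤ))
      hi′ = cast
        (solve 4 (λ k l x y → con -1ℤ :* (k :* y :+ l :* x) :+ con -1ℤ :* x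
          := :- (k :* y :+ l :* x :+ x)) refl k l g′ g″)
        (solve 4 (λ k l x y → con -1ℤ :* (k :* y :+ l :* x) :+ (con -1ℤ :* x :- con 1ℤ)
          := :- (k :* y :+ l :* x :- con 1ℤ :+ (x :+ con 1ℤ) :+ con 1ℤ)) refl k l g g′)
        (pos-+ (pos-scale _ _ p) pos-1-scale)

    -- The remainder -βⁱ (k β - l - 1) is still negative after gaining βⁱ.
    floor-J+G∉ : ∀ k l → Pos k (l + 1ℤ) →
      Floor (k * g″ + l * g′) (k * g′ + l * g - 1ℤ) →
      Floor (k * g″ + l * g′ + g′) (k * g′ + l * g - 1ℤ + (g + 0ℤ))
    floor-J+G∉ k l p (lo , _) = lo′ , hi′
      where
      lo′ : NonNeg (k * g″ + l * g′ + g′) (k * g′ + l * g - 1ℤ + (g + 0ℤ))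
      lo′ = pos⇒nonNeg (cast
        (solve 4 (λ k l x y → con -1ℤ :* (con 0ℤ :* y :+ con -1ℤ :* x) :+ (k :* y :+ l :* x)
          := k :* y :+ l :* x :+ x) refl k l g′ g″)
        (solve 4 (λ k l x y → con -1ℤ :* (con 0ℤ :* y :+ con -1ℤ :* x) :+ (k :* y :+ l :* x :- con 1ℤ)
          := k :* y :+ l :* x :- con 1ℤ :+ (x :+ con 0ℤ)) refl k l g g′)
        (pos+nonNeg (pos-scale 0ℤ -1ℤ pos-1) lo))
      hi′ : Pos (- (k * g″ + l * g′ + g′)) (- (k * g′ + l * g - 1ℤ + (g + 0ℤ) + 1ℤ))
      hi′ = cast
        (solve 4 (λ k l x y → con -1ℤ :* (k :* y :+ (l :+ con 1ℤ) :* x)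
          := :- (k :* y :+ l :* x :+ x)) refl k l g′ g″)
        (solve 4 (λ k l x y → con -1ℤ :* (k :* y :+ (l :+ con 1ℤ) :* x)
          := :- (k :* y :+ l :* x :- con 1ℤ :+ (x :+ con 0ℤ) :+ con 1ℤ)) refl k l g g′)
        (pos-scale _ _ p)

  -- The values of ε on and off the exceptional set.

  floor-0 : ⌊β· 0ℤ ⌋ ≡ 0ℤ
  floor-0 = floor-≡ {0ℤ} {0ℤ} (pos-irrefl , pos-1)

  increment : ∀ g g′ {j n} e → Floor j n → Floor (j + g′) (n + (g + e)) →
    ⌊β· j + g′ ⌋ - ⌊β· j ⌋ - g ≡ e
  increment g g′ {j} {n} e h h′ rewrite floor-≡ {j} h | floor-≡ {j + g′} h′ =
    solve 3 (λ n g e → n :+ (g :+ e) :- n :- g := e) refl n g e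

  Exceptional : (s g′ g″ j : ℤ) → Set
  Exceptional s g′ g″ j =
    (∃[ k ] k ≢ 0ℤ × j ≡ k * g″ + ⌊β· k ⌋ * g′) ⊎ j ≡ ((s - 1ℤ) ℤ./ + 2) * g′

  dichotomy : ∀ s g g′ g″ → s ≡ 1ℤ ⊎ s ≡ -1ℤ →
    (∀ k l → Pos k l → Pos (s * (k * g″ + l * g′)) (s * (k * g′ + l * g))) →
    (∀ k l → NonNeg k l → NonNeg (s * (k * g″ + l * g′)) (s * (k * g′ + l * g))) →
    Pos (s * g′) (s * g - 1ℤ) →
    (∀ j n → ∃[ k ] ∃[ l ] j ≡ k * g″ + l * g′ × n ≡ k * g′ + l * g) →
    ∀ j → let e = ⌊β· j + g′ ⌋ - ⌊β· j ⌋ - g in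
      (¬ Exceptional s g′ g″ j → e ≡ 0ℤ) × (Exceptional s g′ g″ j → e ≡ -1ℤ * s)
  dichotomy s g g′ g″ (inj₁ refl) pos-scale nonNeg-scale pos-1-scale onto j = ∉⇒ , ∈⇒
    where
    open Even g g′ g″ pos-scale nonNeg-scale pos-1-scale
    at : ∀ k l → Floor k l → j ≡ k * g″ + l * g′ → ⌊β· j + g′ ⌋ - ⌊β· j ⌋ - g ≡ -1ℤ
    at k l h refl = increment g g′ {j} -1ℤ (floor-J k l h) (floor-J+G∈ k l h)
    ∈⇒ : Exceptional 1ℤ g′ g″ j → ⌊β· j + g′ ⌋ - ⌊β· j ⌋ - g ≡ -1ℤ
    ∈⇒ (inj₁ (k , _ , j≡)) = at k ⌊β· k ⌋ (proj₂ (floor k)) j≡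
    -- For s = 1 the last element of U is 0, the image of (0 , 0).
    ∈⇒ (inj₂ j≡)           = at 0ℤ 0ℤ (pos-irrefl , pos-1) j≡
    floor∈ : ∀ k l → Floor k l → j ≡ k * g″ + l * g′ → Exceptional 1ℤ g′ g″ j
    floor∈ k l h j≡ with k ℤ.≟ 0ℤ | floor-≡ {k} h
    ... | no k≢0   | refl = inj₁ (k , k≢0 , j≡)
    ... | yes refl | refl = inj₂ (trans j≡ (cong (λ l → 0ℤ + l * g′) floor-0))
    avoid : ¬ Exceptional 1ℤ g′ g″ j → ∀ k l n → j ≡ k * g″ + l * g′ → n ≡ k * g′ + l * g →
      Floor j n → ⌊β· j + g′ ⌋ - ⌊β· j ⌋ - g ≡ 0ℤ
    -- With n = ⌊j β⌋, 0 ≤ j β - n gives l ≤ k β. Either l + 1 ≤ k β, or l = ⌊k β⌋ and j is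
    -- exceptional.
    avoid j∉ k l n refl refl h@(lo , _) with nonNeg? k (l + 1ℤ)
    ... | inj₁ q = increment g g′ {j} 0ℤ h (floor-J+G∉ k l q h)
    ... | inj₂ p = ⊥-elim (j∉ (floor∈ k l (lo′ , p) refl))
      where
      neg-J : ∀ x y → 1ℤ * (- k * y + - l * x) ≡ - (k * y + l * x)
      neg-J = solve 4 (λ k l x y → con 1ℤ :* (:- k :* y :+ :- l :* x)
        := :- (k :* y :+ l :* x)) refl k l
      lo′ : NonNeg k l
      lo′ p = lo (cast (neg-J g′ g″) (neg-J g g′) (pos-scale _ _ p))
    ∉⇒ : ¬ Exceptional 1ℤ g′ g″ j → ⌊β· j + g′ ⌋ - ⌊β· j ⌋ - g ≡ 0ℤ
    ∉⇒ j∉ with k , l , j≡ , n≡ ← onto j ⌊β· j ⌋ = avoid j∉ k l ⌊β· j ⌋ j≡ n≡ (proj₂ (floor j))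
  dichotomy s g g′ g″ (inj₂ refl) pos-scale nonNeg-scale pos-1-scale onto j = ∉⇒ , ∈⇒
    where
    open Odd g g′ g″ pos-scale nonNeg-scale pos-1-scale
    at : ∀ k l → Pos k l → NonNeg (- k) (- (l + 1ℤ)) → j ≡ k * g″ + l * g′ →
      ⌊β· j + g′ ⌋ - ⌊β· j ⌋ - g ≡ 1ℤ
    at k l p q refl = increment g g′ {j} 1ℤ (floor-J k l p q) (floor-J+G∈ k l p q)
    ∈⇒ : Exceptional -1ℤ g′ g″ j → ⌊β· j + g′ ⌋ - ⌊β· j ⌋ - g ≡ 1ℤ
    ∈⇒ (inj₁ (k , k≢0 , j≡)) with lo , hi ← proj₂ (floor k) =
      at k ⌊β· k ⌋ (nonNeg⇒pos k≢0 lo) (pos⇒nonNeg hi) j≡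
    -- For s = -1 the last element of U is -g′, the image of (0 , -1).
    ∈⇒ (inj₂ j≡) = at 0ℤ -1ℤ pos-1 pos-irrefl
      (trans j≡ (sym (ℤ.+-identityˡ _)))
    floor∈ : ∀ k l → Pos k l → Pos (- k) (- (l + 1ℤ)) → j ≡ k * g″ + l * g′ →
      Exceptional -1ℤ g′ g″ j
    floor∈ k l p hi j≡ with k ℤ.≟ 0ℤ | floor-≡ {k} (pos⇒nonNeg p , hi)
    ... | no k≢0   | refl = inj₁ (k , k≢0 , j≡)
    -- k = 0 forces l = ⌊0⌋ = 0, against k β - l > 0.
    ... | yes refl | refl = ⊥-elim (pos-irrefl (cast refl floor-0 p))
    avoid : ¬ Exceptional -1ℤ g′ g″ j → ∀ k l n → j ≡ k * g″ + l * g′ →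
      n + 1ℤ ≡ k * g′ + l * g → Floor j n → ⌊β· j + g′ ⌋ - ⌊β· j ⌋ - g ≡ 0ℤ
    -- The preimage is taken at ⌊j β⌋ + 1, since here the floor is one below the second coordinate.
    -- Then j β < n + 1 gives l < k β. Comparing k β with l + 1 leaves three cases: above it ε
    -- vanishes, equality means (k , l) = (0 , -1), and below it l = ⌊k β⌋.
    avoid j∉ k l n refl n+1≡ h@(_ , hi) with sign k (l + 1ℤ)
    ... | pos p = increment g g′ {j} 0ℤ h′ (floor-J+G∉ k l p h′)
      where
      h′ : Floor j (k * g′ + l * g - 1ℤ)
      h′ = subst (Floor j) (trans (solve 1 (λ n → n := n :+ con 1ℤ :- con 1ℤ) refl n)
             (cong (_- 1ℤ) n+1≡)) h
    ... | zero k≡0 l+1≡0 = ⊥-elim (j∉ (inj₂ (begin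
      k * g″ + l * g′                ≡⟨ solve 4 (λ k l x y → k :* y :+ l :* x
                                         := k :* y :+ (l :+ con 1ℤ) :* x :+ con -1ℤ :* x) refl k l g′ g″ ⟩
      k * g″ + (l + 1ℤ) * g′ + -1ℤ * g′ ≡⟨ cong₂ (λ k l → k * g″ + l * g′ + -1ℤ * g′) k≡0 l+1≡0 ⟩
      0ℤ + -1ℤ * g′                  ≡⟨ ℤ.+-identityˡ _ ⟩
      -1ℤ * g′                       ∎)))
      where open ≡-Reasoning
    ... | neg p = ⊥-elim (j∉ (floor∈ k l lo′ p refl))
      where
      lo′ : Pos k l
      lo′ with sign k l
      ... | pos p = p
      ... | zero refl refl = ⊥-elim (pos-irrefl (cast refl (cong -_ n+1≡) hi))
      ... | neg p = ⊥-elim (pos⇒nonNeg (pos-scale _ _ p) (cast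
              (solve 4 (λ k l x y → :- (k :* y :+ l :* x)
                := :- (con -1ℤ :* (:- k :* y :+ :- l :* x))) refl k l g′ g″)
              (trans (cong -_ n+1≡) (solve 4 (λ k l x y → :- (k :* y :+ l :* x)
                := :- (con -1ℤ :* (:- k :* y :+ :- l :* x))) refl k l g g′))
              hi))
    ∉⇒ : ¬ Exceptional -1ℤ g′ g″ j → ⌊β· j + g′ ⌋ - ⌊β· j ⌋ - g ≡ 0ℤ
    ∉⇒ j∉ with k , l , j≡ , n≡ ← onto j (⌊β· j ⌋ + 1ℤ) =
      avoid j∉ k l ⌊β· j ⌋ j≡ n≡ (proj₂ (floor j))

  -1^-sign : ∀ i → -1ℤ ^ i ≡ 1ℤ ⊎ -1ℤ ^ i ≡ -1ℤ
  -1^-sign zero = inj₁ refl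
  -1^-sign (suc i) with -1^-sign i
  ... | inj₁ p = inj₂ (cong (-1ℤ *_) p)
  ... | inj₂ p = inj₁ (cong (-1ℤ *_) p)

  ε-dichotomy : ∀ i j →
    (¬ Defs.U m ⌊β·_⌋ (suc i) j → Defs.ε m ⌊β·_⌋ (suc i) j ≡ 0ℤ) ×
    (Defs.U m ⌊β·_⌋ (suc i) j → Defs.ε m ⌊β·_⌋ (suc i) j ≡ -1ℤ ^ suc (suc i))
  ε-dichotomy i = dichotomy (-1ℤ ^ suc i) (Defs.G m i) (Defs.G m (suc i)) (Defs.G m (suc (suc i)))
    (-1^-sign (suc i)) (pos-βⁱ* i) (nonNeg-βⁱ* i) (pos-1-βⁱ i) (G-surjective i)

-- Integers inside ℚ and elementary estimates.

module Rationals where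

  open import Data.Rational.Base using (_+_; _*_; _-_; -_; _<_; _≤_)

  fromℚᵘ-homo-+ : ∀ p q → fromℚᵘ (p ℚᵘ.+ q) ≡ fromℚᵘ p + fromℚᵘ q
  fromℚᵘ-homo-+ p q = ℚ.toℚᵘ-injective (begin
    toℚᵘ (fromℚᵘ (p ℚᵘ.+ q))              ≈⟨ ℚ.toℚᵘ-fromℚᵘ (p ℚᵘ.+ q) ⟩
    p ℚᵘ.+ q                              ≈⟨ ℚᵘ.+-cong (ℚ.toℚᵘ-fromℚᵘ p) (ℚ.toℚᵘ-fromℚᵘ q) ⟨
    toℚᵘ (fromℚᵘ p) ℚᵘ.+ toℚᵘ (fromℚᵘ q)  ≈⟨ ℚ.toℚᵘ-homo-+ (fromℚᵘ p) (fromℚᵘ q) ⟨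
    toℚᵘ (fromℚᵘ p + fromℚᵘ q)            ∎)
    where open ℚᵘ.≃-Reasoning

  fromℚᵘ-homo-* : ∀ p q → fromℚᵘ (p ℚᵘ.* q) ≡ fromℚᵘ p * fromℚᵘ q
  fromℚᵘ-homo-* p q = ℚ.toℚᵘ-injective (begin
    toℚᵘ (fromℚᵘ (p ℚᵘ.* q))              ≈⟨ ℚ.toℚᵘ-fromℚᵘ (p ℚᵘ.* q) ⟩
    p ℚᵘ.* q                              ≈⟨ ℚᵘ.*-cong (ℚ.toℚᵘ-fromℚᵘ p) (ℚ.toℚᵘ-fromℚᵘ q) ⟨
    toℚᵘ (fromℚᵘ p) ℚᵘ.* toℚᵘ (fromℚᵘ q)  ≈⟨ ℚ.toℚᵘ-homo-* (fromℚᵘ p) (fromℚᵘ q) ⟨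
    toℚᵘ (fromℚᵘ p * fromℚᵘ q)            ∎)
    where open ℚᵘ.≃-Reasoning

  /1-homo-+ : ∀ a b → (a ℤ.+ b) / 1 ≡ a / 1 + b / 1
  /1-homo-+ a b = trans
    (cong (_/ 1) (sym (cong₂ ℤ._+_ (ℤ.*-identityʳ a) (ℤ.*-identityʳ b))))
    (fromℚᵘ-homo-+ (ℚᵘ.mkℚᵘ a 0) (ℚᵘ.mkℚᵘ b 0))

  /1-homo-* : ∀ a b → (a ℤ.* b) / 1 ≡ a / 1 * (b / 1)
  /1-homo-* a b = fromℚᵘ-homo-* (ℚᵘ.mkℚᵘ a 0) (ℚᵘ.mkℚᵘ b 0)

  /1-homo-neg : ∀ a → (ℤ.- a) / 1 ≡ - (a / 1)
  /1-homo-neg a = begin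
    (ℤ.- a) / 1                   ≡⟨ solve 2 (λ x y → y := x :+ y :- x) refl (a / 1) ((ℤ.- a) / 1) ⟩
    a / 1 + (ℤ.- a) / 1 - a / 1   ≡⟨ cong (_- a / 1) (/1-homo-+ a (ℤ.- a)) ⟨
    (a ℤ.- a) / 1 - a / 1         ≡⟨ cong (λ x → x / 1 - a / 1) (ℤ.+-inverseʳ a) ⟩
    0ℚ - a / 1                    ≡⟨ ℚ.+-identityˡ _ ⟩
    - (a / 1)                     ∎
    where
    open ≡-Reasoning
    open ℚ-Solver.+-*-Solver

  *-pos : ∀ {p q} → 0ℚ < p → 0ℚ < q → 0ℚ < p * q
  *-pos {p} {q} p>0 q>0 =
    ℚ.positive⁻¹ (p * q) {{ℚ.pos*pos⇒pos p {{positive p>0}} q {{positive q>0}}}}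

  p≤∣p∣ : ∀ p → p ≤ ∣ p ∣
  p≤∣p∣ p with ℚ.≤-total 0ℚ p
  ... | inj₁ 0≤p = ℚ.≤-reflexive (sym (ℚ.0≤p⇒∣p∣≡p 0≤p))
  ... | inj₂ p≤0 = ℚ.≤-trans p≤0 (ℚ.0≤∣p∣ p)

  small-factor : ∀ c {t} → 0ℚ < t → ∃[ η ] 0ℚ < η × ∣ c ∣ * η ≤ t
  -- η = t / (1 + ∣ c ∣); the 1 keeps the divisor positive even for c = 0.
  small-factor c {t} t>0 = D⁻¹ * t , η>0 , (begin
    ∣ c ∣ * (D⁻¹ * t)  ≤⟨ ℚ.*-monoʳ-≤-nonNeg (D⁻¹ * t) {{nonNegative (ℚ.<⇒≤ η>0)}} c≤D ⟩
    D * (D⁻¹ * t)      ≡⟨ ℚ.*-assoc D D⁻¹ t ⟨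
    D * D⁻¹ * t        ≡⟨ cong (_* t) (ℚ.*-inverseʳ D) ⟩
    1ℚ * t             ≡⟨ ℚ.*-identityˡ t ⟩
    t                  ∎)
    where
    open ℚ.≤-Reasoning
    D = 1ℚ + ∣ c ∣
    instance
      D-pos : Positive D
      D-pos = positive (ℚ.+-mono-<-≤ (ℚ.positive⁻¹ 1ℚ) (ℚ.0≤∣p∣ c))
      D-nonZero : NonZero D
      D-nonZero = ℚ.pos⇒nonZero D
    D⁻¹ = 1/ D
    η>0 : 0ℚ < D⁻¹ * t
    η>0 = *-pos (ℚ.positive⁻¹ D⁻¹ {{ℚ.1/pos⇒pos D}}) t>0
    c≤D : ∣ c ∣ ≤ D
    c≤D = subst (_≤ D) (ℚ.+-identityˡ ∣ c ∣) (ℚ.+-monoˡ-≤ ∣ c ∣ (ℚ.<⇒≤ (ℚ.positive⁻¹ 1ℚ)))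

-- The order of the reals as a positivity predicate.

module BelowMultiple
  (m : ℕ) (β : Defs.ℝ) (0<β : Defs.0ℝ Defs.< β)
  (β²+mβ≈1 : β Defs.* β Defs.+ Defs.fromℤ (+ m) Defs.* β Defs.≈ Defs.1ℝ)
  where

  open import Data.Rational.Base using (_+_; _*_; _-_; -_; _<_; _≤_)
  open Rationals
  open ℚ-Solver.+-*-Solver

  Below : ℤ → ℤ → Set
  Below k l = Defs.fromℤ l Defs.< β Defs.* Defs.fromℤ k

  private
    b = Defs.seq β
    δ₀ = proj₁ 0<β
    δ₀>0 = proj₁ (proj₂ 0<β)
    N₀ = proj₁ (proj₂ (proj₂ 0<β))
    h₀ = proj₂ (proj₂ (proj₂ 0<β))

  below-+ : ∀ {k l k′ l′} → Below k l → Below k′ l′ → Below (k ℤ.+ k′) (l ℤ.+ l′)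
  below-+ {k} {l} {k′} {l′} (δ , δ>0 , N , h) (δ′ , δ′>0 , N′ , h′) =
    δ + δ′ , ℚ.+-mono-< δ>0 δ′>0 , N ⊔ N′ , λ n N⊔N′≤n → begin
      (l ℤ.+ l′) / 1 + (δ + δ′)
        ≡⟨ cong (_+ (δ + δ′)) (/1-homo-+ l l′) ⟩
      l / 1 + l′ / 1 + (δ + δ′)
        ≡⟨ solve 4 (λ l l′ δ δ′ → l :+ l′ :+ (δ :+ δ′) := l :+ δ :+ (l′ :+ δ′))
             refl (l / 1) (l′ / 1) δ δ′ ⟩
      l / 1 + δ + (l′ / 1 + δ′)
        ≤⟨ ℚ.+-mono-≤ (h n (ℕ.m⊔n≤o⇒m≤o N N′ N⊔N′≤n)) (h′ n (ℕ.m⊔n≤o⇒n≤o N N′ N⊔N′≤n)) ⟩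
      b n * (k / 1) + b n * (k′ / 1)
        ≡⟨ ℚ.*-distribˡ-+ (b n) (k / 1) (k′ / 1) ⟨
      b n * (k / 1 + k′ / 1)
        ≡⟨ cong (b n *_) (/1-homo-+ k k′) ⟨
      b n * ((k ℤ.+ k′) / 1) ∎
    where open ℚ.≤-Reasoning

  below-irrefl : ¬ Below 0ℤ 0ℤ
  below-irrefl (δ , δ>0 , N , h) = ℚ.<-irrefl refl (ℚ.<-≤-trans δ>0 (begin
    δ           ≡⟨ ℚ.+-identityˡ δ ⟨
    0ℚ + δ      ≤⟨ h N ℕ.≤-refl ⟩
    b N * 0ℚ    ≡⟨ ℚ.*-zeroʳ (b N) ⟩
    0ℚ          ∎))
    where open ℚ.≤-Reasoning

  below-1 : Below 0ℤ -1ℤ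
  below-1 = 1ℚ , ℚ.positive⁻¹ 1ℚ , 0 , λ n _ → ℚ.≤-reflexive (sym (ℚ.*-zeroʳ (b n)))

  below-β : Below 1ℤ 0ℤ
  below-β = δ₀ , δ₀>0 , N₀ , λ n N≤n →
    subst (0ℚ + δ₀ ≤_) (sym (ℚ.*-identityʳ (b n))) (h₀ n N≤n)

  -- For a late term x of β, x (x κ - l) ≥ δ δ₀. This product exceeds κ - (m κ + l) x by κ (x² + m x
  -- - 1). The equation for β bounds that error by half of δ δ₀, and the other half is the margin of
  -- the conclusion.
  below-β* : ∀ {k l} → Below k l → Below (ℤ.- (+ m ℤ.* k ℤ.+ l)) (ℤ.- k)
  below-β* {k} {l} (δ , δ>0 , N , h)
    with δδ₀>0 ← *-pos δ>0 δ₀>0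
    with τ>0 ← *-pos (ℚ.positive⁻¹ ½) δδ₀>0
    with η , η>0 , κη≤τ ← small-factor (k / 1) τ>0
    with M , hη ← β²+mβ≈1 η η>0
    = ½ * (δ * δ₀) , τ>0 , (N ⊔ N₀) ⊔ M , λ n n≥ →
      let n≥N⊔N₀ = ℕ.m⊔n≤o⇒m≤o (N ⊔ N₀) M n≥ in
      bound (b n) (h n (ℕ.m⊔n≤o⇒m≤o N N₀ n≥N⊔N₀))
        (subst (_≤ b n) (ℚ.+-identityˡ δ₀) (h₀ n (ℕ.m⊔n≤o⇒n≤o N N₀ n≥N⊔N₀)))
        (ℚ.≤-trans
          (ℚ.*-monoˡ-≤-nonNeg ∣ κ ∣ {{ℚ.∣-∣-nonNeg κ}}
            (ℚ.<⇒≤ (hη n (ℕ.m⊔n≤o⇒n≤o (N ⊔ N₀) M n≥))))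
          κη≤τ)
    where
    open ℚ.≤-Reasoning
    κ = k / 1
    μ = + m / 1
    τ = ½ * (δ * δ₀)
    bound : ∀ x → l / 1 + δ ≤ x * κ → δ₀ ≤ x →
            ∣ κ ∣ * ∣ x * x + μ * x - 1ℚ ∣ ≤ τ →
            (ℤ.- k) / 1 + τ ≤ x * ((ℤ.- (+ m ℤ.* k ℤ.+ l)) / 1)
    bound x hx δ₀≤x hκ = begin
      (ℤ.- k) / 1 + τ
        ≡⟨ cong (_+ τ) (/1-homo-neg k) ⟩
      - κ + τ
        ≡⟨ solve 3 (λ κ δ δ₀ → :- κ :+ con ½ :* (δ :* δ₀)
             := δ :* δ₀ :- con ½ :* (δ :* δ₀) :- κ) refl κ δ δ₀ ⟩
      δ * δ₀ - τ - κ
        ≤⟨ ℚ.+-monoˡ-≤ (- κ) (ℚ.+-mono-≤ δδ₀≤ (ℚ.neg-antimono-≤ κη≤)) ⟩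
      (x * κ - l / 1) * x - κ * (x * x + μ * x - 1ℚ) - κ
        ≡⟨ solve 4 (λ x κ l μ → (x :* κ :- l) :* x :- κ :* (x :* x :+ μ :* x :- con 1ℚ) :- κ
             := x :* (:- (μ :* κ :+ l))) refl x κ (l / 1) μ ⟩
      x * (- (μ * κ + l / 1))
        ≡⟨ cong (λ y → x * (- (y + l / 1))) (/1-homo-* (+ m) k) ⟨
      x * (- ((+ m ℤ.* k) / 1 + l / 1))
        ≡⟨ cong (λ y → x * (- y)) (/1-homo-+ (+ m ℤ.* k) l) ⟨
      x * (- ((+ m ℤ.* k ℤ.+ l) / 1))
        ≡⟨ cong (x *_) (/1-homo-neg (+ m ℤ.* k ℤ.+ l)) ⟨
      x * ((ℤ.- (+ m ℤ.* k ℤ.+ l)) / 1) ∎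
      where
      δ≤ : δ ≤ x * κ - l / 1
      δ≤ = begin
        δ                     ≡⟨ solve 2 (λ l δ → δ := l :+ δ :- l) refl (l / 1) δ ⟩
        l / 1 + δ - l / 1     ≤⟨ ℚ.+-monoˡ-≤ (- (l / 1)) hx ⟩
        x * κ - l / 1         ∎
      δδ₀≤ : δ * δ₀ ≤ (x * κ - l / 1) * x
      δδ₀≤ = begin
        δ * δ₀                ≤⟨ ℚ.*-monoˡ-≤-nonNeg δ {{nonNegative (ℚ.<⇒≤ δ>0)}} δ₀≤x ⟩
        δ * x                 ≤⟨ ℚ.*-monoʳ-≤-nonNeg x
                                   {{nonNegative (ℚ.≤-trans (ℚ.<⇒≤ δ₀>0) δ₀≤x)}} δ≤ ⟩
        (x * κ - l / 1) * x   ∎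
      κη≤ : κ * (x * x + μ * x - 1ℚ) ≤ τ
      κη≤ = begin
        κ * (x * x + μ * x - 1ℚ)          ≤⟨ p≤∣p∣ _ ⟩
        ∣ κ * (x * x + μ * x - 1ℚ) ∣      ≡⟨ ℚ.∣p*q∣≡∣p∣*∣q∣ κ _ ⟩
        ∣ κ ∣ * ∣ x * x + μ * x - 1ℚ ∣    ≤⟨ hκ ⟩
        τ                                 ∎

  -- Together with its converse, this identifies `NonNeg k l` for `Below` with
  -- `fromℤ l ≤ β * fromℤ k`.
  neg-below⇒> : ∀ {k l} → Below (ℤ.- k) (ℤ.- l) → β Defs.* Defs.fromℤ k Defs.< Defs.fromℤ l
  neg-below⇒> {k} {l} (δ , δ>0 , N , h) = δ , δ>0 , N , λ n N≤n → begin
    b n * (k / 1) + δ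
      ≡⟨ solve 4 (λ x κ l δ → x :* κ :+ δ := :- l :+ δ :+ (x :* κ :+ l)) refl (b n) (k / 1) (l / 1) δ ⟩
    - (l / 1) + δ + (b n * (k / 1) + l / 1)
      ≡⟨ cong (λ y → y + δ + (b n * (k / 1) + l / 1)) (/1-homo-neg l) ⟨
    (ℤ.- l) / 1 + δ + (b n * (k / 1) + l / 1)
      ≤⟨ ℚ.+-monoˡ-≤ (b n * (k / 1) + l / 1) (h n N≤n) ⟩
    b n * ((ℤ.- k) / 1) + (b n * (k / 1) + l / 1)
      ≡⟨ cong (λ y → b n * y + (b n * (k / 1) + l / 1)) (/1-homo-neg k) ⟩
    b n * (- (k / 1)) + (b n * (k / 1) + l / 1)
      ≡⟨ solve 3 (λ x κ l → x :* (:- κ) :+ (x :* κ :+ l) := l) refl (b n) (k / 1) (l / 1) ⟩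
    l / 1 ∎
    where open ℚ.≤-Reasoning

  >⇒neg-below : ∀ {k l} → β Defs.* Defs.fromℤ k Defs.< Defs.fromℤ l → Below (ℤ.- k) (ℤ.- l)
  >⇒neg-below {k} {l} (δ , δ>0 , N , h) = δ , δ>0 , N , λ n N≤n → begin
    (ℤ.- l) / 1 + δ
      ≡⟨ cong (_+ δ) (/1-homo-neg l) ⟩
    - (l / 1) + δ
      ≡⟨ solve 4 (λ x κ l δ → :- l :+ δ := x :* κ :+ δ :+ (x :* (:- κ) :- l)) refl (b n) (k / 1) (l / 1) δ ⟩
    b n * (k / 1) + δ + (b n * (- (k / 1)) - l / 1)
      ≤⟨ ℚ.+-monoˡ-≤ (b n * (- (k / 1)) - l / 1) (h n N≤n) ⟩
    l / 1 + (b n * (- (k / 1)) - l / 1)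
      ≡⟨ solve 2 (λ l y → l :+ (y :- l) := y) refl (l / 1) (b n * (- (k / 1))) ⟩
    b n * (- (k / 1))
      ≡⟨ cong (b n *_) (/1-homo-neg k) ⟨
    b n * ((ℤ.- k) / 1) ∎
    where open ℚ.≤-Reasoning

-- Transfer of the floors from ℤ[β] to the real β.

open import Defs

theorem2 : (m : ℕ) → 1 ℕ.≤ m →
    (β : ℝ) → 0ℝ < β → β < 1ℝ → β * β + fromℤ (+ m) * β ≈ 1ℝ →
    Σ[ ⌊β·_⌋ ∈ (ℤ → ℤ) ]
    (∀ k → IsFloor (β * fromℤ k) ⌊β· k ⌋) ×
    ((i : ℕ) → 1 ℕ.≤ i → (j : ℤ) →
    (j ∉ U m ⌊β·_⌋ i → ε m ⌊β·_⌋ i j ≡ 0ℤ) ×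
    (j ∈ U m ⌊β·_⌋ i → ε m ⌊β·_⌋ i j ≡ -1ℤ ^ suc i))
theorem2 m 1≤m β 0<β _ β²+mβ≈1 = ⌊β·_⌋ , isFloor , λ { (suc i) _ j → ε-dichotomy i j }
  where
  open BelowMultiple m β 0<β β²+mβ≈1
  open Positivity m 1≤m Below
    (λ {k} {l} {k′} {l′} → below-+ {k} {l} {k′} {l′}) (λ {k} {l} → below-β* {k} {l})
    below-irrefl below-1 below-β
  isFloor : ∀ k → IsFloor (β * fromℤ k) ⌊β· k ⌋
  isFloor k with n , lo , hi ← floor k =
    (λ βk<n → lo (>⇒neg-below {k} {n} βk<n)) ,
    -- z ≤ k β < n + 1 gives z < n + 1 between integers.
    (λ z z≤βk → <+1⇒≤ (≤kβ<⇒< {k} {z} {n ℤ.+ 1ℤ} (λ p → z≤βk (neg-below⇒> {k} {z} p)) hi))
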